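{- Let $m\ge 2$, let $A\in\mathbb{R}^{m\times m}$ be a symmetric matrix with zero diagonal and nonnegative entries, and let $k\in\{1,\ldots,\lfloor m/2\rfloor\}$. Let $A_k$ be the $(2m-2k)\times(2m-2k)$ symmetric matrix with zero diagonal given in block form by \[ A_k:=\begin{bmatrix} A & \mathbf{1}_{m,m-2k}\\ \mathbf{1}_{m-2k,m} & \mathbf{0}\end{bmatrix}, \] where $\mathbf{1}_{p,q}$ is the $p\times q$ matrix all of whose entries equal $1$ and $\mathbf{0}$ is the $(m-2k)\times(m-2k)$ zero matrix. Then \[ \mathrm{haf}_k A=\frac{\mathrm{haf}\, A_k}{(m-2k)!}. \]
   Context: For a real symmetric $2n\times 2n$ matrix $C=[c_{ij}]$, let $\mathcal{M}(K_{2n})$ be the set of perfect matchings of the complete graph on $\{1,\ldots,2n\}$, each written as $\{(i_1,j_1),\ldots,(i_n,j_n)\}$ with $i_l<j_l$; the hafnian is $\mathrm{haf}\, C:=\sum_{\{(i_1,j_1),\ldots,(i_n,j_n)\}\in\mathcal{M}(K_{2n})}\prod_{l=1}^n c_{i_lj_l}$ (and $\mathrm{haf}$ of the empty $0\times 0$ matrix is $1$). For $1\le 2k\le m$, $Q_{2k,m}$ is the set of $2k$-element subsets $\alpha=\{\alpha_1<\cdots<\alpha_{2k}\}$ of $\{1,\ldots,m\}$, $A[\alpha,\alpha]:=[a_{\alpha_i\alpha_j}]_{i,j=1}^{2k}$, and $\mathrm{haf}_k A:=\sum_{\alpha\in Q_{2k,m}}\mathrm{haf}\, A[\alpha,\alpha]$.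 -}

module Defs where

open import Algebra.Bundles using (CommutativeRing)
import Algebra.Definitions
open import Algebra.Structures using (IsCommutativeRing)
open import Data.Fin using (Fin; _<?_)
open import Data.Fin.Properties using (all?) renaming (_≟_ to _≟ᶠ_)
import Data.Integer as ℤ
open import Data.List
  using (List; []; _∷_; map; _++_; filter; foldr; length; lookup; allFin; cartesianProduct)
open import Data.Nat as ℕ using (ℕ; _∸_)
import Data.Nat.Properties as ℕₚ
open import Data.Product using (_×_; _,_; ∃; proj₁; proj₂)
open import Data.Rational as ℚ using (ℚ; 0ℚ; 1ℚ; ∣_∣)
import Data.Rational.Properties as ℚₚ
import Data.Rational.Unnormalised as ℚᵘ
import Data.Rational.Unnormalised.Properties as ℚᵘₚ
open import Data.Rational.Solver using (module +-*-Solver)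
open import Data.Sum using (_⊎_)
import Data.Vec.Functional as Vector
open import Level using (0ℓ)
open import Relation.Binary.PropositionalEquality
  using (_≡_; refl; sym; trans; cong; cong₂; subst; subst₂)
open import Relation.Binary.Structures using (IsEquivalence)
open import Relation.Nullary using (Dec)
open import Relation.Nullary.Decidable using (_⊎-dec_)

-- The real numbers as Cauchy sequences of rationals, with the operations taken
-- pointwise and equality being the setoid equality _≈_.
module Real where

  open import Data.Rational using (_<_; _-_) renaming (_+_ to _+ᵠ_; _*_ to _*ᵠ_; -_ to -ᵠ_)

  Cauchy : (ℕ → ℚ) → Set
  Cauchy x = ∀ ε → 0ℚ < ε →
    ∃ λ N → ∀ m n → N ℕ.≤ m → N ℕ.≤ n → ∣ x m - x n ∣ < ε

  record ℝ : Set where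
    constructor mkℝ
    field
      seq    : ℕ → ℚ
      cauchy : Cauchy seq

  open ℝ public

  infix 4 _≈_ _≤_

  _≈_ : ℝ → ℝ → Set
  x ≈ y = ∀ ε → 0ℚ < ε →
    ∃ λ N → ∀ n → N ℕ.≤ n → ∣ seq x n - seq y n ∣ < ε

  _≤_ : ℝ → ℝ → Set
  x ≤ y = ∀ ε → 0ℚ < ε →
    ∃ λ N → ∀ n → N ℕ.≤ n → seq x n < seq y n +ᵠ ε

  private
    half : ∀ ε → 0ℚ < ε → 0ℚ < ε *ᵠ ℚ.½
    half ε 0<ε = subst (_< ε *ᵠ ℚ.½) (ℚₚ.*-zeroˡ ℚ.½) (ℚₚ.*-monoˡ-<-pos ℚ.½ 0<ε)

    half+half : ∀ ε → ε *ᵠ ℚ.½ +ᵠ ε *ᵠ ℚ.½ ≡ ε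
    half+half ε =
      trans (sym (ℚₚ.*-distribˡ-+ ε ℚ.½ ℚ.½)) (ℚₚ.*-identityʳ ε)

    ∣p-p∣<ε : ∀ p {ε} → 0ℚ < ε → ∣ p - p ∣ < ε
    ∣p-p∣<ε p {ε} 0<ε = subst (_< ε) (sym (cong ∣_∣ (ℚₚ.+-inverseʳ p))) 0<ε

    ∣-∣-swap : ∀ p q → ∣ p - q ∣ ≡ ∣ q - p ∣
    ∣-∣-swap p q = trans (sym (ℚₚ.∣-p∣≡∣p∣ (p - q))) (cong ∣_∣ lem)
      where
      open +-*-Solver
      lem : -ᵠ (p - q) ≡ q - p
      lem = solve 2 (λ a b → :- (a :- b) := b :- a) refl p q

    ∣p+q∣<ε : ∀ p q {ε} → ∣ p ∣ < ε *ᵠ ℚ.½ → ∣ q ∣ < ε *ᵠ ℚ.½ → ∣ p +ᵠ q ∣ < ε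
    ∣p+q∣<ε p q {ε} p< q< = ℚₚ.≤-<-trans (ℚₚ.∣p+q∣≤∣p∣+∣q∣ p q)
      (subst (∣ p ∣ +ᵠ ∣ q ∣ <_) (half+half ε) (ℚₚ.+-mono-< p< q<))

    ∣-∣-triangle : ∀ p q r {ε} →
      ∣ p - q ∣ < ε *ᵠ ℚ.½ → ∣ q - r ∣ < ε *ᵠ ℚ.½ → ∣ p - r ∣ < ε
    ∣-∣-triangle p q r {ε} a b =
      subst (λ t → ∣ t ∣ < ε) lem (∣p+q∣<ε (p - q) (q - r) a b)
      where
      open +-*-Solver
      lem : (p - q) +ᵠ (q - r) ≡ p - r
      lem = solve 3 (λ p q r → (p :- q) :+ (q :- r) := p :- r) refl p q r

    ∣-∣-+ : ∀ p q p′ q′ {ε} →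
      ∣ p - p′ ∣ < ε *ᵠ ℚ.½ → ∣ q - q′ ∣ < ε *ᵠ ℚ.½ →
      ∣ (p +ᵠ q) - (p′ +ᵠ q′) ∣ < ε
    ∣-∣-+ p q p′ q′ {ε} a b =
      subst (λ t → ∣ t ∣ < ε) lem (∣p+q∣<ε (p - p′) (q - q′) a b)
      where
      open +-*-Solver
      lem : (p - p′) +ᵠ (q - q′) ≡ (p +ᵠ q) - (p′ +ᵠ q′)
      lem = solve 4 (λ p q p′ q′ →
        (p :- p′) :+ (q :- q′) := (p :+ q) :- (p′ :+ q′)) refl p q p′ q′

    ∣-∣-neg : ∀ p q → ∣ -ᵠ p - -ᵠ q ∣ ≡ ∣ p - q ∣
    ∣-∣-neg p q = trans (cong ∣_∣ lem) (∣-∣-swap q p)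
      where
      open +-*-Solver
      lem : -ᵠ p - -ᵠ q ≡ q - p
      lem = solve 2 (λ p q → :- p :- :- q := q :- p) refl p q

    ∣p∣*∣q∣<Bδ : ∀ p q B δ → 0ℚ < B → ∣ p ∣ ℚ.≤ B → ∣ q ∣ < δ → ∣ p *ᵠ q ∣ < B *ᵠ δ
    ∣p∣*∣q∣<Bδ p q B δ 0<B p≤ q< = subst (_< B *ᵠ δ) (sym (ℚₚ.∣p*q∣≡∣p∣*∣q∣ p q))
      (ℚₚ.≤-<-trans
        (ℚₚ.*-monoʳ-≤-nonNeg ∣ q ∣ {{ℚₚ.∣-∣-nonNeg q}} p≤)
        (ℚₚ.*-monoʳ-<-pos B {{ℚ.positive 0<B}} q<))

    ∣-∣-* : ∀ p q p′ q′ B C δ → 0ℚ < B → 0ℚ < C → ∣ p ∣ ℚ.≤ B → ∣ q′ ∣ ℚ.≤ C →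
      ∣ p - p′ ∣ < δ → ∣ q - q′ ∣ < δ →
      ∣ p *ᵠ q - p′ *ᵠ q′ ∣ < (B +ᵠ C) *ᵠ δ
    ∣-∣-* p q p′ q′ B C δ 0<B 0<C p≤ q′≤ a b =
      subst₂ (λ s t → ∣ s ∣ < t) lem (sym (ℚₚ.*-distribʳ-+ δ B C))
        (ℚₚ.≤-<-trans (ℚₚ.∣p+q∣≤∣p∣+∣q∣ (p *ᵠ (q - q′)) (q′ *ᵠ (p - p′)))
          (ℚₚ.+-mono-< (∣p∣*∣q∣<Bδ p (q - q′) B δ 0<B p≤ b)
                       (∣p∣*∣q∣<Bδ q′ (p - p′) C δ 0<C q′≤ a)))
      where
      open +-*-Solver
      lem : p *ᵠ (q - q′) +ᵠ q′ *ᵠ (p - p′) ≡ p *ᵠ q - p′ *ᵠ q′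
      lem = solve 4 (λ p q p′ q′ →
        p :* (q :- q′) :+ q′ :* (p :- p′) := p :* q :- p′ :* q′) refl p q p′ q′

    bounded : ∀ x → Cauchy x →
      ∃ λ B → 0ℚ < B × (∃ λ N → ∀ n → N ℕ.≤ n → ∣ x n ∣ ℚ.≤ B)
    bounded x cx with cx 1ℚ (ℚₚ.positive⁻¹ 1ℚ)
    ... | N , h = 1ℚ +ᵠ ∣ x N ∣ ,
      ℚₚ.<-≤-trans (ℚₚ.positive⁻¹ 1ℚ)
        (subst (ℚ._≤ 1ℚ +ᵠ ∣ x N ∣) (ℚₚ.+-identityʳ 1ℚ)
          (ℚₚ.+-monoʳ-≤ 1ℚ (ℚₚ.0≤∣p∣ (x N)))) ,
      N , λ n N≤n →
        subst (λ t → ∣ t ∣ ℚ.≤ 1ℚ +ᵠ ∣ x N ∣) (lem (x n) (x N))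
          (ℚₚ.≤-trans (ℚₚ.∣p+q∣≤∣p∣+∣q∣ (x n - x N) (x N))
            (ℚₚ.+-monoˡ-≤ ∣ x N ∣ (ℚₚ.<⇒≤ (h n N N≤n ℕₚ.≤-refl))))
      where
      open +-*-Solver
      lem : ∀ p q → (p - q) +ᵠ q ≡ p
      lem = solve 2 (λ p q → (p :- q) :+ q := p) refl

    scale : ∀ B ε → 0ℚ < B → 0ℚ < ε → ∃ λ δ → 0ℚ < δ × B *ᵠ δ ≡ ε
    scale B ε 0<B 0<ε = 1/B *ᵠ ε ,
      ℚₚ.positive⁻¹ _
        {{ℚₚ.pos*pos⇒pos 1/B {{ℚₚ.1/pos⇒pos B {{B⁺}}}} ε {{ℚ.positive 0<ε}}}} ,
      trans (sym (ℚₚ.*-assoc B 1/B ε))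
        (trans (cong (_*ᵠ ε) (ℚₚ.*-inverseʳ B {{B≢0}})) (ℚₚ.*-identityˡ ε))
      where
      B⁺ : ℚ.Positive B
      B⁺ = ℚ.positive 0<B
      B≢0 : ℚ.NonZero B
      B≢0 = ℚₚ.pos⇒nonZero B {{B⁺}}
      1/B : ℚ
      1/B = (ℚ.1/ B) {{B≢0}}

    1/n*n≡1 : ∀ n .{{_ : ℕ.NonZero n}} → (ℤ.+ 1 ℚ./ n) *ᵠ (ℤ.+ n ℚ./ 1) ≡ 1ℚ
    1/n*n≡1 n@(ℕ.suc k) = ℚₚ.toℚᵘ-injective
      (ℚᵘₚ.≃-trans (ℚₚ.toℚᵘ-homo-* (ℤ.+ 1 ℚ./ n) (ℤ.+ n ℚ./ 1))
      (ℚᵘₚ.≃-trans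
        (ℚᵘₚ.*-cong (ℚₚ.toℚᵘ-fromℚᵘ (ℚᵘ.mkℚᵘ (ℤ.+ 1) k))
                    (ℚₚ.toℚᵘ-fromℚᵘ (ℚᵘ.mkℚᵘ (ℤ.+ n) 0)))
        (ℚᵘₚ.*-inverseˡ (ℚᵘ.mkℚᵘ (ℤ.+ n) 0))))

    0<B+C : ∀ {B C} → 0ℚ < B → 0ℚ < C → 0ℚ < B +ᵠ C
    0<B+C {B} {C} b c = ℚₚ.positive⁻¹ _
      {{ℚₚ.pos+pos⇒pos B {{ℚ.positive b}} C {{ℚ.positive c}}}}

    ⊔ˡ : ∀ a b {n} → a ℕ.⊔ b ℕ.≤ n → a ℕ.≤ n
    ⊔ˡ a b = ℕₚ.m⊔n≤o⇒m≤o a b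

    ⊔ʳ : ∀ a b {n} → a ℕ.⊔ b ℕ.≤ n → b ℕ.≤ n
    ⊔ʳ a b = ℕₚ.m⊔n≤o⇒n≤o a b

  infixl 6 _+_
  infixl 7 _*_ _÷_
  infix  8 -_

  fromℚ : ℚ → ℝ
  fromℚ q = mkℝ (λ _ → q) λ ε 0<ε → 0 , λ _ _ _ _ → ∣p-p∣<ε q 0<ε

  0ℝ 1ℝ : ℝ
  0ℝ = fromℚ 0ℚ
  1ℝ = fromℚ 1ℚ

  fromℕ : ℕ → ℝ
  fromℕ n = fromℚ (ℤ.+ n ℚ./ 1)

  _+_ : ℝ → ℝ → ℝ
  mkℝ x cx + mkℝ y cy = mkℝ (λ n → x n +ᵠ y n) λ ε 0<ε →
    let (N₁ , h₁) = cx (ε *ᵠ ℚ.½) (half ε 0<ε)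
        (N₂ , h₂) = cy (ε *ᵠ ℚ.½) (half ε 0<ε)
    in N₁ ℕ.⊔ N₂ , λ m n N≤m N≤n → ∣-∣-+ (x m) (y m) (x n) (y n)
         (h₁ m n (⊔ˡ N₁ N₂ N≤m) (⊔ˡ N₁ N₂ N≤n))
         (h₂ m n (⊔ʳ N₁ N₂ N≤m) (⊔ʳ N₁ N₂ N≤n))

  -_ : ℝ → ℝ
  - mkℝ x cx = mkℝ (λ n → -ᵠ x n) λ ε 0<ε →
    let (N , h) = cx ε 0<ε
    in N , λ m n N≤m N≤n →
         subst (_< ε) (sym (∣-∣-neg (x m) (x n))) (h m n N≤m N≤n)

  private
    *-cauchy : ∀ x y → Cauchy x → Cauchy y → Cauchy (λ n → x n *ᵠ y n)
    *-cauchy x y cx cy ε 0<ε =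
      let (B , 0<B , K , hB) = bounded x cx
          (C , 0<C , L , hC) = bounded y cy
          (δ , 0<δ , eq)     = scale (B +ᵠ C) ε (0<B+C 0<B 0<C) 0<ε
          (N₁ , h₁)          = cx δ 0<δ
          (N₂ , h₂)          = cy δ 0<δ
          N₃ = N₁ ℕ.⊔ N₂
          K₃ = K ℕ.⊔ L
      in N₃ ℕ.⊔ K₃ , λ m n N≤m N≤n →
        let m₁ = ⊔ˡ N₃ K₃ N≤m
            n₁ = ⊔ˡ N₃ K₃ N≤n
        in subst (∣ x m *ᵠ y m - x n *ᵠ y n ∣ <_) eq
             (∣-∣-* (x m) (y m) (x n) (y n) B C δ 0<B 0<C
               (hB m (⊔ˡ K L (⊔ʳ N₃ K₃ N≤m))) (hC n (⊔ʳ K L (⊔ʳ N₃ K₃ N≤n)))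
               (h₁ m n (⊔ˡ N₁ N₂ m₁) (⊔ˡ N₁ N₂ n₁))
               (h₂ m n (⊔ʳ N₁ N₂ m₁) (⊔ʳ N₁ N₂ n₁)))

  _*_ : ℝ → ℝ → ℝ
  mkℝ x cx * mkℝ y cy = mkℝ (λ n → x n *ᵠ y n) (*-cauchy x y cx cy)

  -- Division by a positive integer, see ÷-cancel.
  _÷_ : ℝ → (n : ℕ) → .{{ℕ.NonZero n}} → ℝ
  x ÷ n = x * fromℚ (ℤ.+ 1 ℚ./ n)

  ≡⇒≈ : ∀ {x y} → (∀ n → seq x n ≡ seq y n) → x ≈ y
  ≡⇒≈ {x} {y} eq ε 0<ε = 0 , λ n _ →
    subst (λ t → ∣ seq x n - t ∣ < ε) (eq n) (∣p-p∣<ε (seq x n) 0<ε)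

  ÷-cancel : ∀ x n .{{_ : ℕ.NonZero n}} → (x ÷ n) * fromℕ n ≈ x
  ÷-cancel x n = ≡⇒≈ {(x ÷ n) * fromℕ n} {x} λ i →
    trans (ℚₚ.*-assoc (seq x i) (ℤ.+ 1 ℚ./ n) (ℤ.+ n ℚ./ 1))
      (trans (cong (seq x i *ᵠ_) (1/n*n≡1 n)) (ℚₚ.*-identityʳ (seq x i)))

  ≈-isEquivalence : IsEquivalence _≈_
  ≈-isEquivalence = record
    { refl  = λ {x} → ≡⇒≈ {x} {x} (λ _ → refl)
    ; sym   = λ {x} {y} x≈y ε 0<ε → let (N , h) = x≈y ε 0<ε in
        N , λ n N≤n → subst (_< ε) (∣-∣-swap (seq x n) (seq y n)) (h n N≤n)
    ; trans = λ {x} {y} {z} x≈y y≈z ε 0<ε →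
        let (N₁ , h₁) = x≈y (ε *ᵠ ℚ.½) (half ε 0<ε)
            (N₂ , h₂) = y≈z (ε *ᵠ ℚ.½) (half ε 0<ε)
        in N₁ ℕ.⊔ N₂ , λ n N≤n → ∣-∣-triangle (seq x n) (seq y n) (seq z n)
             (h₁ n (⊔ˡ N₁ N₂ N≤n)) (h₂ n (⊔ʳ N₁ N₂ N≤n))
    }

  open Algebra.Definitions _≈_ using (Congruent₁; Congruent₂)

  +-cong : Congruent₂ _+_
  +-cong {x} {x′} {y} {y′} x≈ y≈ ε 0<ε =
    let (N₁ , h₁) = x≈ (ε *ᵠ ℚ.½) (half ε 0<ε)
        (N₂ , h₂) = y≈ (ε *ᵠ ℚ.½) (half ε 0<ε)
    in N₁ ℕ.⊔ N₂ , λ n N≤n →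
         ∣-∣-+ (seq x n) (seq y n) (seq x′ n) (seq y′ n)
           (h₁ n (⊔ˡ N₁ N₂ N≤n)) (h₂ n (⊔ʳ N₁ N₂ N≤n))

  -‿cong : Congruent₁ (-_)
  -‿cong {x} {x′} x≈ ε 0<ε = let (N , h) = x≈ ε 0<ε in
    N , λ n N≤n →
      subst (_< ε) (sym (∣-∣-neg (seq x n) (seq x′ n))) (h n N≤n)

  *-cong : Congruent₂ _*_
  *-cong {x} {x′} {y} {y′} x≈ y≈ ε 0<ε =
    let (B , 0<B , K , hB) = bounded (seq x) (cauchy x)
        (C , 0<C , L , hC) = bounded (seq y′) (cauchy y′)
        (δ , 0<δ , eq)     = scale (B +ᵠ C) ε (0<B+C 0<B 0<C) 0<ε
        (N₁ , h₁)          = x≈ δ 0<δ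
        (N₂ , h₂)          = y≈ δ 0<δ
        N₃ = N₁ ℕ.⊔ N₂
        K₃ = K ℕ.⊔ L
    in N₃ ℕ.⊔ K₃ , λ n N≤n →
      subst (∣ seq x n *ᵠ seq y n - seq x′ n *ᵠ seq y′ n ∣ <_) eq
        (∣-∣-* (seq x n) (seq y n) (seq x′ n) (seq y′ n) B C δ 0<B 0<C
          (hB n (⊔ˡ K L (⊔ʳ N₃ K₃ N≤n))) (hC n (⊔ʳ K L (⊔ʳ N₃ K₃ N≤n)))
          (h₁ n (⊔ˡ N₁ N₂ (⊔ˡ N₃ K₃ N≤n)))
          (h₂ n (⊔ʳ N₁ N₂ (⊔ˡ N₃ K₃ N≤n))))

  isCommutativeRing : IsCommutativeRing _≈_ _+_ _*_ (-_) 0ℝ 1ℝ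
  isCommutativeRing = record
    { isRing = record
      { +-isAbelianGroup = record
        { isGroup = record
          { isMonoid = record
            { isSemigroup = record
              { isMagma = record
                { isEquivalence = ≈-isEquivalence
                ; ∙-cong = λ {x} {x′} {y} {y′} → +-cong {x} {x′} {y} {y′}
                }
              ; assoc = λ x y z → ≡⇒≈ {(x + y) + z} {x + (y + z)}
                  (λ n → ℚₚ.+-assoc (seq x n) (seq y n) (seq z n))
              }
            ; identity =
                (λ x → ≡⇒≈ {0ℝ + x} {x} (λ n → ℚₚ.+-identityˡ (seq x n)))
              , (λ x → ≡⇒≈ {x + 0ℝ} {x} (λ n → ℚₚ.+-identityʳ (seq x n)))
            }
          ; inverse =
              (λ x → ≡⇒≈ { - x + x} {0ℝ} (λ n → ℚₚ.+-inverseˡ (seq x n)))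
            , (λ x → ≡⇒≈ {x + - x} {0ℝ} (λ n → ℚₚ.+-inverseʳ (seq x n)))
          ; ⁻¹-cong = λ {x} {x′} → -‿cong {x} {x′}
          }
        ; comm = λ x y → ≡⇒≈ {x + y} {y + x}
            (λ n → ℚₚ.+-comm (seq x n) (seq y n))
        }
      ; *-cong = λ {x} {x′} {y} {y′} → *-cong {x} {x′} {y} {y′}
      ; *-assoc = λ x y z → ≡⇒≈ {(x * y) * z} {x * (y * z)}
          (λ n → ℚₚ.*-assoc (seq x n) (seq y n) (seq z n))
      ; *-identity =
          (λ x → ≡⇒≈ {1ℝ * x} {x} (λ n → ℚₚ.*-identityˡ (seq x n)))
        , (λ x → ≡⇒≈ {x * 1ℝ} {x} (λ n → ℚₚ.*-identityʳ (seq x n)))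
      ; distrib =
          (λ x y z → ≡⇒≈ {x * (y + z)} {x * y + x * z}
            (λ n → ℚₚ.*-distribˡ-+ (seq x n) (seq y n) (seq z n)))
        , (λ x y z → ≡⇒≈ {(y + z) * x} {y * x + z * x}
            (λ n → ℚₚ.*-distribʳ-+ (seq x n) (seq y n) (seq z n)))
      }
    ; *-comm = λ x y → ≡⇒≈ {x * y} {y * x}
        (λ n → ℚₚ.*-comm (seq x n) (seq y n))
    }

  commutativeRing : CommutativeRing 0ℓ 0ℓ
  commutativeRing = record { isCommutativeRing = isCommutativeRing }

open Real public using (ℝ; 0ℝ; 1ℝ) renaming (_≈_ to _≈ℝ_; _≤_ to _≤ℝ_; _÷_ to _÷ℝ_)

-- All sublists, one per set of positions, each in the original order.
sublists : ∀ {a} {A : Set a} → List A → List (List A)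
sublists []       = [] ∷ []
sublists (x ∷ xs) = map (x ∷_) (sublists xs) ++ sublists xs

Edge : ℕ → Set
Edge N = Fin N × Fin N

edges : ∀ N → List (Edge N)
edges N = filter (λ (i , j) → i <? j) (cartesianProduct (allFin N) (allFin N))

Incident : ∀ {N} → Fin N → Edge N → Set
Incident v (i , j) = v ≡ i ⊎ v ≡ j

incident? : ∀ {N} (v : Fin N) (e : Edge N) → Dec (Incident v e)
incident? v (i , j) = (v ≟ᶠ i) ⊎-dec (v ≟ᶠ j)

IsPerfect : ∀ {N} → List (Edge N) → Set
IsPerfect M = ∀ v → length (filter (incident? v) M) ≡ 1

isPerfect? : ∀ {N} (M : List (Edge N)) → Dec (IsPerfect M)
isPerfect? M = all? λ v → length (filter (incident? v) M) ℕ.≟ 1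

-- Every edge set of K_N occurs exactly once among `sublists (edges N)`.
perfectMatchings : ∀ N → List (List (Edge N))
perfectMatchings N = filter isPerfect? (sublists (edges N))

-- The p-element subsets of {1,…,m}, as increasing lists.
Q : ℕ → (m : ℕ) → List (List (Fin m))
Q p m = filter (λ α → length α ℕ.≟ p) (sublists (allFin m))

Matrix : ∀ {a} → Set a → ℕ → ℕ → Set a
Matrix A p q = Fin p → Fin q → A

_[_] : ∀ {a} {A : Set a} {m} → Matrix A m m → (α : List (Fin m)) →
  Matrix A (length α) (length α)
(A [ α ]) i j = A (lookup α i) (lookup α j)

block : ∀ {a} {A : Set a} {p q r s} →
  Matrix A p r → Matrix A p s → Matrix A q r → Matrix A q s →
  Matrix A (p ℕ.+ q) (r ℕ.+ s)
block A B C D =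
  (λ i → A i Vector.++ B i) Vector.++ (λ i → C i Vector.++ D i)

module Hafnian {c ℓ} (R : CommutativeRing c ℓ) where

  open CommutativeRing R

  ∑ : ∀ {a} {I : Set a} → List I → (I → Carrier) → Carrier
  ∑ xs f = foldr _+_ 0# (map f xs)

  ∏ : ∀ {a} {I : Set a} → List I → (I → Carrier) → Carrier
  ∏ xs f = foldr _*_ 1# (map f xs)

  -- Defined for every order N; for odd N there are no perfect matchings and
  -- the value is 0#.  Not indexing by n with N = 2n avoids casting matrices of
  -- order m + (m ∸ 2k) to order 2(m ∸ k).  A matching M lists its edges (i , j)
  -- with i < j.
  haf : ∀ {N} → Matrix Carrier N N → Carrier
  haf {N} C = ∑ (perfectMatchings N) λ M → ∏ M λ (i , j) → C i j

  hafₖ : ℕ → ∀ {m} → Matrix Carrier m m → Carrier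
  hafₖ k {m} A = ∑ (Q (2 ℕ.* k) m) λ α → haf (A [ α ])

  bordered : ∀ {m} → Matrix Carrier m m → (k : ℕ) →
    Matrix Carrier (m ℕ.+ (m ∸ 2 ℕ.* k)) (m ℕ.+ (m ∸ 2 ℕ.* k))
  bordered A k = block A (λ _ _ → 1#) (λ _ _ → 1#) (λ _ _ → 0#)

open Hafnian Real.commutativeRing public

{-# OPTIONS --safe #-}
-- Call hafList the function on lists of vertices given by the expansion along
-- the first vertex, haf (x ∷ xs) = ∑_{y ∈ xs} c x y · haf (xs \ y).  Splitting
-- the edge sets by the edges at the first vertex shows that it computes the
-- hafnian.  In A_k an extra vertex is only joined, with weight 1, to the
-- original vertices, so for H xs r, the hafnian on the original vertices xs and
-- r extra ones, the expansion reads
--   H (x ∷ xs) r = ∑_{y ∈ xs} a x y · H (xs \ y) r + r · H xs (r − 1).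
-- The sum of haf α over the α ⊆ xs omitting exactly r elements, multiplied by
-- r!, satisfies the same recursion: the two terms are the α with and without x.
module Submission where

open import Algebra.Bundles using (CommutativeRing)
open import Data.Bool using (true; false)
open import Data.Empty using (⊥-elim)
open import Data.Fin using (Fin; _↑ˡ_; _↑ʳ_; splitAt; _<?_) renaming (_<_ to _<ᶠ_; zero to fzero; suc to fsuc)
open import Data.Fin.Properties using (all?; splitAt-↑ˡ; splitAt-↑ʳ)
  renaming (_≟_ to _≟ᶠ_; <-irrefl to <ᶠ-irrefl; <-asym to <ᶠ-asym)
import Data.Integer as ℤ
import Data.Integer.Properties as ℤₚ
open import Data.List
  using (List; []; _∷_; _++_; foldr; map; filter; length; lookup; allFin; cartesianProduct)
open import Data.List.Properties
  using (map-∘; map-id; map-cong; map-++; map-tabulate; tabulate-lookup; length-tabulate;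
    length-map; length-++; filter-++; filter-all; filter-none; filter-accept; filter-reject; filter-≐;
    filter-some; ++-assoc; ++-identityʳ)
open import Data.List.Membership.Propositional.Properties using (∈-allFin)
open import Data.List.Relation.Binary.Sublist.Propositional using (_⊆_; []; _∷_; _∷ʳ_; ⊆-refl; ⊆-trans)
open import Data.List.Relation.Binary.Sublist.Propositional.Properties using (All-resp-⊆) renaming (++⁺ to ⊆-++⁺)
open import Data.List.Relation.Unary.All as All using (All; []; _∷_)
open import Data.List.Relation.Unary.All.Properties using (++⁺; ∷ʳ⁺; map⁺)
open import Data.List.Relation.Unary.AllPairs using (AllPairs; []; _∷_)
open import Data.List.Relation.Unary.AllPairs.Properties using (tabulate⁺-<)
open import Data.List.Relation.Unary.Unique.Propositional using (Unique)
open import Data.List.Relation.Unary.Unique.Propositional.Properties using (allFin⁺)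
open import Data.Nat using (ℕ; zero; suc; _≤_; _<_; s≤s; z≤n; _∸_; _!; NonZero)
  renaming (_+_ to _+ᴺ_; _*_ to _*ᴺ_; _≟_ to _≟ᴺ_)
open import Data.Nat.DivMod using (m/n*n≤m)
open import Data.Nat.Properties as ℕₚ using (_!≢0)
open import Data.Product using (_×_; _,_; proj₁; proj₂; map₂)
import Data.Rational as ℚ
import Data.Rational.Properties as ℚₚ
import Data.Rational.Unnormalised as ℚᵘ
import Data.Rational.Unnormalised.Properties as ℚᵘₚ
open import Data.Sum using (_⊎_; inj₁; inj₂)
open import Function using (_∘_; id)
open import Level using (0ℓ)
open import Relation.Binary.PropositionalEquality as ≡ using (_≡_; _≢_; refl; cong; cong₂; subst)
open import Relation.Nullary using (¬_; yes; no; does)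
open import Relation.Unary using (Decidable)
import Defs
open Defs using (Edge; edges; Incident; incident?; sublists; Q; Matrix; _[_]; module Hafnian; module Real)

private
  variable
    A B I : Set
    N : ℕ

-- Lists: sublists, picking one element, omitting a given number of elements.

filter-map : ∀ {P : B → Set} (P? : Decidable P) (f : A → B) xs →
  filter P? (map f xs) ≡ map f (filter (P? ∘ f) xs)
filter-map P? f [] = refl
filter-map P? f (x ∷ xs) with does (P? (f x))
... | true  = cong (f x ∷_) (filter-map P? f xs)
... | false = filter-map P? f xs

All-sublists : ∀ {P : A → Set} {xs} → All P xs → All (All P) (sublists xs)
All-sublists []         = [] ∷ []
All-sublists (px ∷ pxs) =
  ++⁺ (map⁺ (All.map (px ∷_) (All-sublists pxs))) (All-sublists pxs)

length-sublists : ∀ (xs : List A) → All (λ α → length α ≤ length xs) (sublists xs)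
length-sublists []       = z≤n ∷ []
length-sublists (x ∷ xs) =
  ++⁺ (map⁺ (All.map s≤s (length-sublists xs))) (All.map ℕₚ.m≤n⇒m≤1+n (length-sublists xs))

-- The rest keeps its original order, so an expansion built on `picks` evaluates a weight only at
-- pairs in list order, just as the edges `(i , j)` of a matching have i < j.
picks : List A → List (A × List A)
picks []       = []
picks (x ∷ xs) = (x , xs) ∷ map (map₂ (x ∷_)) (picks xs)

length-picks : ∀ (xs : List A) → length (picks xs) ≡ length xs
length-picks []       = refl
length-picks (x ∷ xs) = cong suc (≡.trans (length-map _ (picks xs)) (length-picks xs))

picks-shorter : ∀ (xs : List A) → All (λ p → length xs ≡ suc (length (proj₂ p))) (picks xs)
picks-shorter []       = []
picks-shorter (x ∷ xs) = refl ∷ map⁺ (All.map (cong suc) (picks-shorter xs))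

picks-map : ∀ (f : A → B) xs →
  picks (map f xs) ≡ map (λ (y , zs) → f y , map f zs) (picks xs)
picks-map f []       = refl
picks-map f (x ∷ xs) = cong ((f x , map f xs) ∷_)
  (≡.trans (cong (map _) (picks-map f xs))
    (≡.trans (≡.sym (map-∘ (picks xs))) (map-∘ (picks xs))))

picks-++ : ∀ (xs ys : List A) →
  picks (xs ++ ys) ≡ map (map₂ (_++ ys)) (picks xs) ++ map (map₂ (xs ++_)) (picks ys)
picks-++ []       ys = ≡.sym (map-id (picks ys))
picks-++ (x ∷ xs) ys = cong ((x , xs ++ ys) ∷_)
  (≡.trans (cong (map _) (picks-++ xs ys))
  (≡.trans (map-++ _ (map _ (picks xs)) _)
    (cong₂ _++_
      (≡.trans (≡.sym (map-∘ (picks xs))) (map-∘ (picks xs)))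
      (≡.sym (map-∘ (picks ys))))))

-- Indexed by the number of omitted elements instead of the length: this number stays the same when
-- two vertices are matched with each other and drops by one when the first vertex is left out, like
-- the number of extra vertices.
omit : ℕ → List A → List (List A)
omit zero    xs       = xs ∷ []
omit (suc r) []       = []
omit (suc r) (x ∷ xs) = map (x ∷_) (omit (suc r) xs) ++ omit r xs

omit-all : ∀ r (xs : List A) → length xs < r → omit r xs ≡ []
omit-all (suc r) []       _ = refl
omit-all (suc r) (x ∷ xs) (s≤s l)
  rewrite omit-all (suc r) xs (ℕₚ.m<n⇒m<1+n l) = omit-all r xs l

-- Induction on the list: a choice containing x has p - 1 elements to take from the tail and still
-- omits r, one without x has p to take and omits r - 1. Both sides list the choices with x first,
-- so they agree as lists and not only up to order.
filter-length-sublists : ∀ p r (xs : List A) → p +ᴺ r ≡ length xs →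
  filter (λ α → length α ≟ᴺ p) (sublists xs) ≡ omit r xs
filter-length-sublists zero    zero    []       eq = refl
filter-length-sublists (suc p) r       []       ()
filter-length-sublists p       r       (x ∷ xs) eq =
  ≡.trans (filter-++ (λ α → length α ≟ᴺ p) (map (x ∷_) (sublists xs)) (sublists xs))
  (≡.trans (cong (_++ filter (λ α → length α ≟ᴺ p) (sublists xs))
      (filter-map (λ α → length α ≟ᴺ p) (x ∷_) (sublists xs)))
    (step p r eq))
  where
  step : ∀ p r → p +ᴺ r ≡ suc (length xs) →
    map (x ∷_) (filter (λ α → suc (length α) ≟ᴺ p) (sublists xs)) ++
    filter (λ α → length α ≟ᴺ p) (sublists xs) ≡ omit r (x ∷ xs)
  -- With p = 0 no choice contains x; the corresponding half of `omit` is empty too, since `suc r`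
  -- exceeds the length of `xs`.
  step zero (suc r) eq = cong₂ _++_
    (cong (map (x ∷_)) (≡.trans
      (filter-none (λ α → suc (length α) ≟ᴺ 0) (All.map (λ _ ()) (length-sublists xs)))
      (≡.sym (omit-all (suc r) xs (ℕₚ.≤-reflexive (≡.sym eq))))))
    (filter-length-sublists zero r xs (ℕₚ.suc-injective eq))
  step (suc p) r eq = ≡.trans
    (cong (λ αs → map (x ∷_) αs ++ filter (λ α → length α ≟ᴺ suc p) (sublists xs))
      (≡.trans (filter-≐ (λ α → suc (length α) ≟ᴺ suc p) (λ α → length α ≟ᴺ p)
          (ℕₚ.suc-injective , cong suc) (sublists xs))
        (filter-length-sublists p r xs (ℕₚ.suc-injective eq))))
    (without r eq)
    where
    without : ∀ r → suc p +ᴺ r ≡ suc (length xs) →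
      map (x ∷_) (omit r xs) ++ filter (λ α → length α ≟ᴺ suc p) (sublists xs) ≡ omit r (x ∷ xs)
    -- Nothing is omitted, so `suc p` is one more than the length of `xs` and no choice without x is
    -- long enough.
    without zero eq = cong ((x ∷ xs) ∷_) (filter-none (λ α → length α ≟ᴺ suc p)
      (All.map (λ l e → ℕₚ.<-irrefl (≡.trans e (≡.trans (≡.sym (ℕₚ.+-identityʳ (suc p))) eq)) (s≤s l))
        (length-sublists xs)))
    without (suc r) eq = cong (map (x ∷_) (omit (suc r) xs) ++_)
      (filter-length-sublists (suc p) r xs
        (ℕₚ.suc-injective (≡.trans (≡.sym (ℕₚ.+-suc (suc p) r)) eq)))

-- The edges of the complete graph, grouped by their smaller endpoint.

pairs : List A → List (A × A)
pairs []       = []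
pairs (x ∷ xs) = map (x ,_) xs ++ pairs xs

-- The prefix `ps` holds the vertices whose rows are done. The row of x still runs over the full
-- vertex list; the test removes `ps` and x itself, after which x joins the prefix.
filter-<-cartesianProduct : ∀ (ps xs : List (Fin N)) →
  All (λ x → All (λ p → ¬ x <ᶠ p) ps) xs → AllPairs _<ᶠ_ xs →
  filter (λ (i , j) → i <? j) (cartesianProduct xs (ps ++ xs)) ≡ pairs xs
filter-<-cartesianProduct ps [] _ _ = refl
filter-<-cartesianProduct ps (x ∷ xs) (x≮ps ∷ xs≮ps) (x<xs ∷ sorted) =
  ≡.trans (filter-++ lt? (map (x ,_) (ps ++ x ∷ xs)) _)
    (cong₂ _++_
      (≡.trans (filter-map lt? (x ,_) (ps ++ x ∷ xs)) (cong (map (x ,_)) row))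
      (≡.trans (cong (λ zs → filter lt? (cartesianProduct xs zs)) (≡.sym (++-assoc ps (x ∷ []) xs)))
        (filter-<-cartesianProduct (ps ++ x ∷ []) xs
          (All.zipWith (λ (≮ps , x<y) → ∷ʳ⁺ ≮ps (<ᶠ-asym x<y)) (xs≮ps , x<xs))
          sorted)))
  where
  lt? = λ (e : _ × _) → proj₁ e <? proj₂ e
  row : filter (x <?_) (ps ++ x ∷ xs) ≡ xs
  row = ≡.trans (filter-++ (x <?_) ps (x ∷ xs))
    (≡.trans (cong (_++ filter (x <?_) (x ∷ xs)) (filter-none (x <?_) x≮ps))
    (≡.trans (filter-reject (x <?_) (<ᶠ-irrefl refl)) (filter-all (x <?_) x<xs)))

edges≡pairs : ∀ N → edges N ≡ pairs (allFin N)
edges≡pairs N =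
  filter-<-cartesianProduct [] (allFin N) (All.universal (λ _ → []) (allFin N)) (tabulate⁺-< id)

pairs-avoid : ∀ {v : Fin N} {xs} → All (v ≢_) xs → All (λ e → ¬ Incident v e) (pairs xs)
pairs-avoid []           = []
pairs-avoid (v≢x ∷ v≢xs) =
  ++⁺ (map⁺ (All.map (λ v≢y → λ { (inj₁ v≡x) → v≢x v≡x ; (inj₂ v≡y) → v≢y v≡y }) v≢xs))
    (pairs-avoid v≢xs)

allFin-+ : ∀ m n → allFin (m +ᴺ n) ≡ map (_↑ˡ n) (allFin m) ++ map (m ↑ʳ_) (allFin n)
allFin-+ zero    n = ≡.sym (map-id (allFin n))
allFin-+ (suc m) n = cong (fzero ∷_)
  (≡.trans (≡.sym (map-tabulate id fsuc))
  (≡.trans (cong (map fsuc) (allFin-+ m n))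
  (≡.trans (map-++ fsuc (map (_↑ˡ n) (allFin m)) _)
    (cong₂ _++_
      (≡.trans (≡.sym (map-∘ (allFin m)))
        (≡.trans (map-tabulate id (λ i → fsuc (i ↑ˡ n))) (≡.sym (map-tabulate fsuc (_↑ˡ n)))))
      (≡.sym (map-∘ (allFin n)))))))

-- Degrees in edge sets and multiplicities in vertex lists.

deg : Fin N → List (Edge N) → ℕ
deg v M = length (filter (incident? v) M)

-- For a list without repetitions this is its indicator function, used as a degree prescription:
-- cover exactly the vertices of D, each once.
count : List (Fin N) → Fin N → ℕ
count D v = length (filter (v ≟ᶠ_) D)

deg-∷ : ∀ (v : Fin N) e M → deg v (e ∷ M) ≡ deg v (e ∷ []) +ᴺ deg v M
deg-∷ v e M = ≡.trans (cong length (filter-++ (incident? v) (e ∷ []) M))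
  (length-++ (filter (incident? v) (e ∷ [])))

count-++ : ∀ D₁ D₂ (v : Fin N) → count (D₁ ++ D₂) v ≡ count D₁ v +ᴺ count D₂ v
count-++ D₁ D₂ v = ≡.trans (cong length (filter-++ (v ≟ᶠ_) D₁ D₂))
  (length-++ (filter (v ≟ᶠ_) D₁))

deg-avoid : ∀ {v : Fin N} {M} → All (λ e → ¬ Incident v e) M → deg v M ≡ 0
deg-avoid {v = v} avoid = cong length (filter-none (incident? v) avoid)

count-avoid : ∀ {v : Fin N} {D} → All (v ≢_) D → count D v ≡ 0
count-avoid {v = v} avoid = cong length (filter-none (v ≟ᶠ_) avoid)

count-self : ∀ (v : Fin N) D → count (v ∷ D) v ≡ suc (count D v)
count-self v D = cong length (filter-accept (v ≟ᶠ_) refl)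

count-unique : ∀ {xs} → Unique xs → (v : Fin N) → count xs v ≤ 1
count-unique [] v = z≤n
count-unique {xs = x ∷ xs} (x≢xs ∷ uniq) v with v ≟ᶠ x
... | yes refl = s≤s (ℕₚ.≤-reflexive (count-avoid x≢xs))
... | no _     = count-unique uniq v

-- A loop would contribute one to the degree but two to the count, hence `x ≢ y`.
deg-edge : ∀ {x y : Fin N} → x ≢ y → ∀ v → deg v ((x , y) ∷ []) ≡ count (x ∷ y ∷ []) v
deg-edge {x = x} {y} x≢y v with v ≟ᶠ x
deg-edge {x = x} {y} x≢y v | yes refl with v ≟ᶠ y
... | yes v≡y = ⊥-elim (x≢y v≡y)
... | no _    = refl
deg-edge {x = x} {y} x≢y v | no _ with v ≟ᶠ y
... | yes _ = refl
... | no _  = refl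

-- Once x and y are matched with each other, the demand that remains is that of `D₁ ++ D₂`. The
-- additive form is the one that `∑-degrees-used` takes.
count-edge : ∀ {x y : Fin N} → x ≢ y → ∀ D₁ D₂ v →
  count (x ∷ D₁ ++ y ∷ D₂) v ≡ deg v ((x , y) ∷ []) +ᴺ count (D₁ ++ D₂) v
count-edge {x = x} {y} x≢y D₁ D₂ v = begin
  count (x ∷ D₁ ++ y ∷ D₂) v                       ≡⟨ count-++ (x ∷ []) (D₁ ++ y ∷ D₂) v ⟩
  cx +ᴺ count (D₁ ++ y ∷ D₂) v                     ≡⟨ cong (cx +ᴺ_) (count-++ D₁ (y ∷ D₂) v) ⟩
  cx +ᴺ (c₁ +ᴺ count (y ∷ D₂) v)                   ≡⟨ cong (λ t → cx +ᴺ (c₁ +ᴺ t)) (count-++ (y ∷ []) D₂ v) ⟩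
  cx +ᴺ (c₁ +ᴺ (cy +ᴺ c₂))                         ≡⟨ cong (cx +ᴺ_) (≡.sym (ℕₚ.+-assoc c₁ cy c₂)) ⟩
  cx +ᴺ (c₁ +ᴺ cy +ᴺ c₂)                           ≡⟨ cong (λ t → cx +ᴺ (t +ᴺ c₂)) (ℕₚ.+-comm c₁ cy) ⟩
  cx +ᴺ (cy +ᴺ c₁ +ᴺ c₂)                           ≡⟨ cong (cx +ᴺ_) (ℕₚ.+-assoc cy c₁ c₂) ⟩
  cx +ᴺ (cy +ᴺ (c₁ +ᴺ c₂))                         ≡⟨ ≡.sym (ℕₚ.+-assoc cx cy (c₁ +ᴺ c₂)) ⟩
  cx +ᴺ cy +ᴺ (c₁ +ᴺ c₂)                           ≡⟨ cong₂ _+ᴺ_ (≡.sym (count-++ (x ∷ []) (y ∷ []) v)) (≡.sym (count-++ D₁ D₂ v)) ⟩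
  count (x ∷ y ∷ []) v +ᴺ count (D₁ ++ D₂) v       ≡⟨ cong (_+ᴺ count (D₁ ++ D₂) v) (≡.sym (deg-edge x≢y v)) ⟩
  deg v ((x , y) ∷ []) +ᴺ count (D₁ ++ D₂) v       ∎
  where
  open ≡.≡-Reasoning
  cx = count (x ∷ []) v
  cy = count (y ∷ []) v
  c₁ = count D₁ v
  c₂ = count D₂ v

count-allFin : ∀ N (v : Fin N) → count (allFin N) v ≡ 1
count-allFin N v = ℕₚ.≤-antisym (count-unique (allFin⁺ N) v) (filter-some (v ≟ᶠ_) (∈-allFin v))

-- `IsPerfect` with the constant 1 replaced by any prescription. Deciding on one edge changes the
-- degrees demanded of the others, so an induction on the edge list leaves the perfect case.
HasDegrees : (Fin N → ℕ) → List (Edge N) → Set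
HasDegrees d M = ∀ v → deg v M ≡ d v

hasDegrees? : (d : Fin N → ℕ) → Decidable (HasDegrees d)
hasDegrees? d M = all? λ v → deg v M ≟ᴺ d v

module Expansion (R : CommutativeRing 0ℓ 0ℓ) where

  open CommutativeRing R hiding (zero; refl)
  open CommutativeRing R using () renaming (refl to ≈-refl)
  open Hafnian R
  open import Algebra.Properties.CommutativeSemigroup +-commutativeSemigroup using (interchange)
  open import Algebra.Properties.Semiring.Mult semiring renaming (_×_ to _⋆_)
  open import Algebra.Properties.CommutativeMonoid.Mult +-commutativeMonoid using (×-distrib-+)
  open import Relation.Binary.Reasoning.Setoid setoid


  -- Finite sums in a commutative ring.

  ∑-congᴬ : ∀ {f g : I → Carrier} {xs} → All (λ x → f x ≈ g x) xs → ∑ xs f ≈ ∑ xs g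
  ∑-congᴬ []         = ≈-refl
  ∑-congᴬ (eq ∷ eqs) = +-cong eq (∑-congᴬ eqs)

  ∑-cong : ∀ {f g : I → Carrier} xs → (∀ x → f x ≈ g x) → ∑ xs f ≈ ∑ xs g
  ∑-cong xs eq = ∑-congᴬ (All.universal eq xs)

  ∑-++ : ∀ (f : I → Carrier) xs ys → ∑ (xs ++ ys) f ≈ ∑ xs f + ∑ ys f
  ∑-++ f []       ys = sym (+-identityˡ _)
  ∑-++ f (x ∷ xs) ys = trans (+-congˡ (∑-++ f xs ys)) (sym (+-assoc _ _ _))

  ∑-map : ∀ (f : B → Carrier) (g : A → B) xs → ∑ (map g xs) f ≡ ∑ xs (f ∘ g)
  ∑-map f g xs = cong (foldr _+_ 0#) (≡.sym (map-∘ xs))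

  ∑-0 : ∀ (xs : List I) → ∑ xs (λ _ → 0#) ≈ 0#
  ∑-0 []       = ≈-refl
  ∑-0 (x ∷ xs) = trans (+-identityˡ _) (∑-0 xs)

  ∑-const : ∀ a (xs : List I) → ∑ xs (λ _ → a) ≈ length xs ⋆ a
  ∑-const a []       = ≈-refl
  ∑-const a (x ∷ xs) = +-congˡ (∑-const a xs)

  ∑-+ : ∀ (f g : I → Carrier) xs → ∑ xs (λ x → f x + g x) ≈ ∑ xs f + ∑ xs g
  ∑-+ f g []       = sym (+-identityˡ 0#)
  ∑-+ f g (x ∷ xs) = trans (+-congˡ (∑-+ f g xs)) (interchange _ _ _ _)

  *-∑ : ∀ a (f : I → Carrier) xs → a * ∑ xs f ≈ ∑ xs (λ x → a * f x)
  *-∑ a f []       = zeroʳ a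
  *-∑ a f (x ∷ xs) = trans (distribˡ a _ _) (+-congˡ (*-∑ a f xs))

  ⋆-∑ : ∀ n (f : I → Carrier) xs → n ⋆ ∑ xs f ≈ ∑ xs (λ x → n ⋆ f x)
  ⋆-∑ n f []       = ⋆-0 n
    where
    ⋆-0 : ∀ n → n ⋆ 0# ≈ 0#
    ⋆-0 zero    = ≈-refl
    ⋆-0 (suc n) = trans (+-identityˡ _) (⋆-0 n)
  ⋆-∑ n f (x ∷ xs) = trans (×-distrib-+ _ _ n) (+-congˡ (⋆-∑ n f xs))

  -- Both sides sum over the ways to pick an element and to omit r others.
  ∑-omit-picks : ∀ r (f : A × List A → Carrier) xs →
    ∑ (omit r xs) (λ α → ∑ (picks α) f) ≈
    ∑ (picks xs) (λ (y , zs) → ∑ (omit r zs) (λ γ → f (y , γ)))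
  ∑-omit-picks zero f xs = begin
    ∑ (picks xs) f + 0#                            ≈⟨ +-identityʳ _ ⟩
    ∑ (picks xs) f                                 ≈⟨ ∑-cong (picks xs) (λ p → sym (+-identityʳ (f p))) ⟩
    ∑ (picks xs) (λ p → f p + 0#)                  ∎
  ∑-omit-picks (suc r) f []       = ≈-refl
  ∑-omit-picks (suc r) f (x ∷ xs) = begin
    ∑ (map (x ∷_) (omit (suc r) xs) ++ omit r xs) (λ α → ∑ (picks α) f)
      ≈⟨ ∑-++ _ (map (x ∷_) (omit (suc r) xs)) (omit r xs) ⟩
    ∑ (map (x ∷_) (omit (suc r) xs)) (λ α → ∑ (picks α) f) + ∑ (omit r xs) (λ α → ∑ (picks α) f)
      ≈⟨ +-cong withx (∑-omit-picks r f xs) ⟩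
    (S + ∑ (picks xs) T₁) + ∑ (picks xs) T₂
      ≈⟨ +-assoc _ _ _ ⟩
    S + (∑ (picks xs) T₁ + ∑ (picks xs) T₂)
      ≈⟨ +-congˡ (sym (∑-+ T₁ T₂ (picks xs))) ⟩
    S + ∑ (picks xs) (λ p → T₁ p + T₂ p)
      ≈⟨ +-congˡ (∑-cong (picks xs) merge) ⟩
    S + ∑ (picks xs) (λ (y , zs) → ∑ (omit (suc r) (x ∷ zs)) (λ γ → f (y , γ)))
      ≡⟨ cong (S +_) (≡.sym (∑-map _ (map₂ (x ∷_)) (picks xs))) ⟩
    S + ∑ (map (map₂ (x ∷_)) (picks xs)) (λ (y , zs) → ∑ (omit (suc r) zs) (λ γ → f (y , γ))) ∎
    where
    -- In `S` the element x is picked, in `T₁` it is kept but another element is picked, in `T₂` it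
    -- is omitted. Together `T₁` and `T₂` cover all omissions from `x ∷ zs`.
    S = ∑ (omit (suc r) xs) (λ α → f (x , α))
    T₁ T₂ : _ → Carrier
    T₁ (y , zs) = ∑ (omit (suc r) zs) (λ γ → f (y , x ∷ γ))
    T₂ (y , zs) = ∑ (omit r zs) (λ γ → f (y , γ))
    merge : ∀ p → T₁ p + T₂ p ≈ ∑ (omit (suc r) (x ∷ proj₂ p)) (λ γ → f (proj₁ p , γ))
    merge (y , zs) = sym (trans (∑-++ _ (map (x ∷_) (omit (suc r) zs)) (omit r zs))
      (+-congʳ (reflexive (∑-map _ (x ∷_) (omit (suc r) zs)))))
    withx : ∑ (map (x ∷_) (omit (suc r) xs)) (λ α → ∑ (picks α) f) ≈ S + ∑ (picks xs) T₁
    withx = begin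
      ∑ (map (x ∷_) (omit (suc r) xs)) (λ α → ∑ (picks α) f)
        ≡⟨ ∑-map _ (x ∷_) (omit (suc r) xs) ⟩
      ∑ (omit (suc r) xs) (λ α → f (x , α) + ∑ (map (map₂ (x ∷_)) (picks α)) f)
        ≈⟨ ∑-+ _ _ (omit (suc r) xs) ⟩
      S + ∑ (omit (suc r) xs) (λ α → ∑ (map (map₂ (x ∷_)) (picks α)) f)
        ≈⟨ +-congˡ (∑-cong (omit (suc r) xs) (λ α → reflexive (∑-map f (map₂ (x ∷_)) (picks α)))) ⟩
      S + ∑ (omit (suc r) xs) (λ α → ∑ (picks α) (f ∘ map₂ (x ∷_)))
        ≈⟨ +-congˡ (∑-omit-picks (suc r) (f ∘ map₂ (x ∷_)) xs) ⟩
      S + ∑ (picks xs) T₁ ∎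

  -- The expansion along the first vertex.

  -- The first argument only serves termination; hafFuel is meaningful when it
  -- is at least the length of the list.
  hafFuel : ℕ → (A → A → Carrier) → List A → Carrier
  hafFuel _       c []       = 1#
  hafFuel zero    c (x ∷ xs) = 0#
  hafFuel (suc n) c (x ∷ xs) = ∑ (picks xs) λ (y , zs) → c x y * hafFuel n c zs

  hafList : (A → A → Carrier) → List A → Carrier
  hafList c xs = hafFuel (length xs) c xs

  -- A step spends one unit of fuel and removes two vertices, so sufficient fuel stays sufficient.
  hafFuel-irrelevant : ∀ m n (c : A → A → Carrier) xs → length xs ≤ m → length xs ≤ n →
    hafFuel m c xs ≈ hafFuel n c xs
  hafFuel-irrelevant m       n       c []       _       _       = ≈-refl
  hafFuel-irrelevant (suc m) (suc n) c (x ∷ xs) (s≤s l) (s≤s k) =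
    ∑-congᴬ (All.map
      (λ {p} eq → *-congˡ (hafFuel-irrelevant m n c (proj₂ p) (bound eq l) (bound eq k)))
      (picks-shorter xs))
    where
    bound : ∀ {i j o} → i ≡ suc j → i ≤ o → j ≤ o
    bound refl = ℕₚ.<⇒≤

  -- True by definition up to fuel: the recursive calls carry `length xs`, which is traded for the
  -- length of their own list.
  hafList-∷ : ∀ (c : A → A → Carrier) x xs →
    hafList c (x ∷ xs) ≈ ∑ (picks xs) λ (y , zs) → c x y * hafList c zs
  hafList-∷ c x xs = ∑-congᴬ (All.map
    (λ {p} eq → *-congˡ (hafFuel-irrelevant _ _ c (proj₂ p)
      (ℕₚ.≤-trans (ℕₚ.n≤1+n _) (ℕₚ.≤-reflexive (≡.sym eq))) ℕₚ.≤-refl))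
    (picks-shorter xs))

  hafFuel-map : ∀ n (c : B → B → Carrier) (f : A → B) xs →
    hafFuel n c (map f xs) ≈ hafFuel n (λ x y → c (f x) (f y)) xs
  hafFuel-map n       c f []       = ≈-refl
  hafFuel-map zero    c f (x ∷ xs) = ≈-refl
  hafFuel-map (suc n) c f (x ∷ xs) = begin
    ∑ (picks (map f xs)) F  ≡⟨ cong (λ ps → ∑ ps F) (picks-map f xs) ⟩
    ∑ (map _ (picks xs)) F  ≡⟨ ∑-map F _ (picks xs) ⟩
    ∑ (picks xs) _          ≈⟨ ∑-cong (picks xs) (λ (y , zs) → *-congˡ (hafFuel-map n c f zs)) ⟩
    ∑ (picks xs) _          ∎
    where
    F : _ → Carrier
    F (y , zs) = c (f x) y * hafFuel n c zs

  hafList-map : ∀ (c : B → B → Carrier) (f : A → B) xs →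
    hafList c (map f xs) ≈ hafList (λ x y → c (f x) (f y)) xs
  hafList-map c f xs = trans (reflexive (cong (λ n → hafFuel n c (map f xs)) (length-map f xs)))
    (hafFuel-map (length xs) c f xs)

  hafFuel-cong : ∀ n {c c′ : A → A → Carrier} → (∀ x y → c x y ≡ c′ x y) →
    ∀ xs → hafFuel n c xs ≈ hafFuel n c′ xs
  hafFuel-cong n       eq []       = ≈-refl
  hafFuel-cong zero    eq (x ∷ xs) = ≈-refl
  hafFuel-cong (suc n) eq (x ∷ xs) =
    ∑-cong (picks xs) λ (y , zs) → *-cong (reflexive (eq x y)) (hafFuel-cong n eq zs)

  -- Expansion in the presence of extra vertices.

  -- The weights of the bordered matrix on a disjoint union of original and extra vertices; the tags
  -- replace arithmetic on the indices of the blocks.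
  adjoin : (A → A → Carrier) → A ⊎ B → A ⊎ B → Carrier
  adjoin c (inj₁ x) (inj₁ y) = c x y
  adjoin c (inj₁ x) (inj₂ y) = 1#
  adjoin c (inj₂ x) (inj₁ y) = 1#
  adjoin c (inj₂ x) (inj₂ y) = 0#

  module _ (c : A → A → Carrier) where

    -- The partner of x is either original or extra; in the second case its weight is 1 and
    -- disappears.
    hafList-adjoin-∷ : ∀ x (xs : List A) (ys : List B) →
      hafList (adjoin c) (map inj₁ (x ∷ xs) ++ map inj₂ ys) ≈
      ∑ (picks xs) (λ (z , zs) → c x z * hafList (adjoin c) (map inj₁ zs ++ map inj₂ ys)) +
      ∑ (picks ys) (λ (z , zs) → hafList (adjoin c) (map inj₁ xs ++ map inj₂ zs))
    hafList-adjoin-∷ x xs ys = begin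
      hafList (adjoin c) (inj₁ x ∷ map inj₁ xs ++ map inj₂ ys)
        ≈⟨ hafList-∷ (adjoin c) (inj₁ x) (map inj₁ xs ++ map inj₂ ys) ⟩
      ∑ (picks (map inj₁ xs ++ map inj₂ ys)) F
        ≡⟨ cong (λ ps → ∑ ps F) (picks-++ (map inj₁ xs) (map inj₂ ys)) ⟩
      ∑ (map (map₂ (_++ map inj₂ ys)) (picks (map inj₁ xs)) ++
         map (map₂ (map inj₁ xs ++_)) (picks (map inj₂ ys))) F
        ≈⟨ ∑-++ F (map (map₂ (_++ map inj₂ ys)) (picks (map inj₁ xs))) _ ⟩
      ∑ (map (map₂ (_++ map inj₂ ys)) (picks (map inj₁ xs))) F +
      ∑ (map (map₂ (map inj₁ xs ++_)) (picks (map inj₂ ys))) F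
        ≡⟨ cong₂ _+_ (reindex inj₁ _ xs) (reindex inj₂ _ ys) ⟩
      ∑ (picks xs) (λ (z , zs) → c x z * hafList (adjoin c) (map inj₁ zs ++ map inj₂ ys)) +
      ∑ (picks ys) (λ (z , zs) → 1# * hafList (adjoin c) (map inj₁ xs ++ map inj₂ zs))
        ≈⟨ +-congˡ (∑-cong (picks ys) (λ _ → *-identityˡ _)) ⟩
      _ ∎
      where
      F : (A ⊎ B) × List (A ⊎ B) → Carrier
      F (y , zs) = adjoin c (inj₁ x) y * hafList (adjoin c) zs
      reindex : ∀ {I : Set} (ι : I → A ⊎ B) g (us : List I) →
        ∑ (map (map₂ g) (picks (map ι us))) F ≡
        ∑ (picks us) (λ (z , zs) → F (ι z , g (map ι zs)))
      reindex ι g us = ≡.trans (∑-map F (map₂ g) (picks (map ι us)))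
        (≡.trans (cong (λ ps → ∑ ps (F ∘ map₂ g)) (picks-map ι us)) (∑-map (F ∘ map₂ g) _ (picks us)))

    -- With no original vertex left, the first extra one has only partners of weight 0, or none at
    -- all.
    hafList-adjoin-[] : ∀ y (ys : List B) → hafList (adjoin c) (map inj₂ (y ∷ ys)) ≈ 0#
    hafList-adjoin-[] y ys = begin
      hafList (adjoin c) (map inj₂ (y ∷ ys))
        ≈⟨ hafList-map (adjoin c) inj₂ (y ∷ ys) ⟩
      hafList (λ _ _ → 0#) (y ∷ ys)
        ≈⟨ hafList-∷ (λ _ _ → 0#) y ys ⟩
      ∑ (picks ys) (λ (z , zs) → 0# * hafList (λ _ _ → 0#) zs)
        ≈⟨ ∑-cong (picks ys) (λ _ → zeroˡ _) ⟩
      ∑ (picks ys) (λ _ → 0#)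
        ≈⟨ ∑-0 (picks ys) ⟩
      0# ∎

    -- The choices that keep x are expanded along x. Then `∑-omit-picks` lets the partner y be
    -- picked before the omissions are made, so that the inner sums again run over omissions.
    ∑-omit-∷ : ∀ r x xs → ∑ (omit (suc r) (x ∷ xs)) (hafList c) ≈
      ∑ (picks xs) (λ (y , zs) → c x y * ∑ (omit (suc r) zs) (hafList c)) + ∑ (omit r xs) (hafList c)
    ∑-omit-∷ r x xs = begin
      ∑ (map (x ∷_) (omit (suc r) xs) ++ omit r xs) (hafList c)
        ≈⟨ ∑-++ _ (map (x ∷_) (omit (suc r) xs)) (omit r xs) ⟩
      ∑ (map (x ∷_) (omit (suc r) xs)) (hafList c) + ∑ (omit r xs) (hafList c)
        ≡⟨ cong (_+ ∑ (omit r xs) (hafList c)) (∑-map _ (x ∷_) (omit (suc r) xs)) ⟩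
      ∑ (omit (suc r) xs) (λ α → hafList c (x ∷ α)) + ∑ (omit r xs) (hafList c)
        ≈⟨ +-congʳ (∑-cong (omit (suc r) xs) (hafList-∷ c x)) ⟩
      ∑ (omit (suc r) xs) (λ α → ∑ (picks α) (λ (y , zs) → c x y * hafList c zs)) + ∑ (omit r xs) (hafList c)
        ≈⟨ +-congʳ (∑-omit-picks (suc r) (λ (y , zs) → c x y * hafList c zs) xs) ⟩
      ∑ (picks xs) (λ (y , zs) → ∑ (omit (suc r) zs) (λ γ → c x y * hafList c γ)) + ∑ (omit r xs) (hafList c)
        ≈⟨ +-congʳ (∑-cong (picks xs) (λ (y , zs) → sym (*-∑ (c x y) (hafList c) (omit (suc r) zs)))) ⟩
      _ ∎

    -- Both sides satisfy the same recursion, by `hafList-adjoin-∷` and `∑-omit-∷`. The bound `n`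
    -- provides the structural descent, because the lists produced by `picks` are not subterms.
    hafList-adjoin : ∀ n r xs (ys : List B) → length xs ≤ n → length ys ≡ r →
      hafList (adjoin c) (map inj₁ xs ++ map inj₂ ys) ≈ (r !) ⋆ ∑ (omit r xs) (hafList c)
    -- The two added zeros come from the one-term sum over `omit 0 xs` and from its single copy, as
    -- 0! = 1.
    hafList-adjoin n .0 xs [] _ refl = begin
      hafList (adjoin c) (map inj₁ xs ++ []) ≡⟨ cong (hafList (adjoin c)) (++-identityʳ (map inj₁ xs)) ⟩
      hafList (adjoin c) (map inj₁ xs)       ≈⟨ hafList-map (adjoin c) inj₁ xs ⟩
      hafList c xs                           ≈⟨ +-identityʳ _ ⟨
      hafList c xs + 0#                      ≈⟨ +-identityʳ _ ⟨
      (hafList c xs + 0#) + 0#               ∎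
    hafList-adjoin n (suc r) [] (y ∷ ys) _ _ =
      trans (hafList-adjoin-[] y ys) (sym (⋆-∑ (suc r !) (hafList c) []))
    hafList-adjoin (suc n) (suc r) (x ∷ xs) ys@(_ ∷ _) (s≤s l) eq = begin
      hafList (adjoin c) (map inj₁ (x ∷ xs) ++ map inj₂ ys)
        ≈⟨ hafList-adjoin-∷ x xs ys ⟩
      ∑ (picks xs) (λ (z , zs) → c x z * hafList (adjoin c) (map inj₁ zs ++ map inj₂ ys)) +
      ∑ (picks ys) (λ (z , zs) → hafList (adjoin c) (map inj₁ xs ++ map inj₂ zs))
        ≈⟨ +-cong
          (∑-congᴬ (All.map
            (λ {(z , zs)} e → *-congˡ (hafList-adjoin n (suc r) zs ys
              (ℕₚ.<⇒≤ (ℕₚ.≤-trans (ℕₚ.≤-reflexive (≡.sym e)) l)) eq))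
            (picks-shorter xs)))
          (∑-congᴬ (All.map
            (λ {(z , zs)} e → hafList-adjoin n r xs zs l (ℕₚ.suc-injective (≡.trans (≡.sym e) eq)))
            (picks-shorter ys))) ⟩
      ∑ (picks xs) (λ (z , zs) → c x z * ((suc r !) ⋆ S zs)) + ∑ (picks ys) (λ _ → (r !) ⋆ T)
        ≈⟨ +-cong
          (trans (∑-cong (picks xs) (λ (z , zs) → ×-comm-* (suc r !) (c x z) (S zs)))
            (sym (⋆-∑ (suc r !) _ (picks xs))))
          -- The r + 1 possible extra partners of x give equal terms, each r! copies of `T`; this
          -- turns r! into (r + 1)!.
          (trans (∑-const _ (picks ys))
            (trans (×-congˡ (≡.trans (length-picks ys) eq)) (×-assocˡ T (suc r) (r !)))) ⟩
      (suc r !) ⋆ ∑ (picks xs) (λ (z , zs) → c x z * S zs) + (suc r !) ⋆ T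
        ≈⟨ ×-distrib-+ _ _ (suc r !) ⟨
      (suc r !) ⋆ (∑ (picks xs) (λ (z , zs) → c x z * S zs) + T)
        ≈⟨ ×-congʳ (suc r !) (∑-omit-∷ r x xs) ⟨
      (suc r !) ⋆ ∑ (omit (suc r) (x ∷ xs)) (hafList c) ∎
      where
      S : List A → Carrier
      S zs = ∑ (omit (suc r) zs) (hafList c)
      T = ∑ (omit r xs) (hafList c)

  -- Sums over edge sets with prescribed degrees, and the hafnian as an expansion.

  module _ (C : Matrix Carrier N N) where

    weight : List (Edge N) → Carrier
    weight M = ∏ M λ (i , j) → C i j

    ∑-degrees : List (Edge N) → (Fin N → ℕ) → Carrier
    ∑-degrees E d = ∑ (filter (hasDegrees? d) (sublists E)) weight

    ∑-degrees-cong : ∀ E {d d′} → (∀ v → d v ≡ d′ v) → ∑-degrees E d ≡ ∑-degrees E d′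
    ∑-degrees-cong E {d} {d′} eq = cong (λ Ms → ∑ Ms weight) (filter-≐ (hasDegrees? d) (hasDegrees? d′)
      ((λ h v → ≡.trans (h v) (eq v)) , (λ h v → ≡.trans (h v) (≡.sym (eq v)))) (sublists E))

    ∑-degrees-∷ : ∀ e E d → ∑-degrees (e ∷ E) d ≈
      ∑ (filter (hasDegrees? d ∘ (e ∷_)) (sublists E)) (weight ∘ (e ∷_)) + ∑-degrees E d
    ∑-degrees-∷ e E d = begin
      ∑ (filter (hasDegrees? d) (map (e ∷_) (sublists E) ++ sublists E)) weight
        ≡⟨ cong (λ Ms → ∑ Ms weight) (filter-++ (hasDegrees? d) (map (e ∷_) (sublists E)) (sublists E)) ⟩
      ∑ (filter (hasDegrees? d) (map (e ∷_) (sublists E)) ++ filter (hasDegrees? d) (sublists E)) weight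
        ≈⟨ ∑-++ weight (filter (hasDegrees? d) (map (e ∷_) (sublists E))) _ ⟩
      ∑ (filter (hasDegrees? d) (map (e ∷_) (sublists E))) weight + ∑-degrees E d
        ≡⟨ cong (λ Ms → ∑ Ms weight + ∑-degrees E d) (filter-map (hasDegrees? d) (e ∷_) (sublists E)) ⟩
      ∑ (map (e ∷_) (filter (hasDegrees? d ∘ (e ∷_)) (sublists E))) weight + ∑-degrees E d
        ≡⟨ cong (_+ ∑-degrees E d) (∑-map weight (e ∷_)
          (filter (hasDegrees? d ∘ (e ∷_)) (sublists E))) ⟩
      _ ∎

    -- Deleting the edge from the sets that contain it leaves the sets with demand `d′`. Writing `d`
    -- as a sum avoids truncated subtraction of degrees.
    ∑-degrees-used : ∀ {x y} E d d′ → (∀ v → d v ≡ deg v ((x , y) ∷ []) +ᴺ d′ v) →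
      ∑-degrees ((x , y) ∷ E) d ≈ C x y * ∑-degrees E d′ + ∑-degrees E d
    ∑-degrees-used {x} {y} E d d′ eq = trans (∑-degrees-∷ e E d) (+-congʳ (begin
      ∑ (filter (hasDegrees? d ∘ (e ∷_)) (sublists E)) (weight ∘ (e ∷_))
        ≡⟨ cong (λ Ms → ∑ Ms (weight ∘ (e ∷_))) (filter-≐ (hasDegrees? d ∘ (e ∷_)) (hasDegrees? d′)
            ( (λ {M} h v → ℕₚ.+-cancelˡ-≡ (deg v (e ∷ [])) _ _
                (≡.trans (≡.sym (deg-∷ v e M)) (≡.trans (h v) (eq v))))
            , (λ {M} h v → ≡.trans (deg-∷ v e M)
                (≡.trans (cong (deg v (e ∷ []) +ᴺ_) (h v)) (≡.sym (eq v)))))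
            (sublists E)) ⟩
      ∑ (filter (hasDegrees? d′) (sublists E)) (λ M → C x y * weight M)
        ≈⟨ *-∑ (C x y) weight (filter (hasDegrees? d′) (sublists E)) ⟨
      C x y * ∑-degrees E d′ ∎))
      where e = x , y

    -- Any set containing the edge would give v a positive degree.
    ∑-degrees-unused : ∀ v e E d → d v ≡ 0 → Incident v e →
      ∑-degrees (e ∷ E) d ≈ ∑-degrees E d
    ∑-degrees-unused v e E d dv≡0 v∈e = trans (∑-degrees-∷ e E d)
      (trans (+-congʳ (reflexive (cong (λ Ms → ∑ Ms (weight ∘ (e ∷_)))
        (filter-none (hasDegrees? d ∘ (e ∷_)) (All.universal contradictory (sublists E))))))
        (+-identityˡ _))
      where
      contradictory : ∀ M → ¬ HasDegrees d (e ∷ M)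
      contradictory M h with ≡.trans (≡.sym (cong length (filter-accept (incident? v) v∈e)))
                               (≡.trans (h v) dv≡0)
      ... | ()

    ∑-degrees-star : ∀ x ys E d → d x ≡ 0 →
      ∑-degrees (map (x ,_) ys ++ E) d ≈ ∑-degrees E d
    ∑-degrees-star x []       E d dx≡0 = ≈-refl
    ∑-degrees-star x (y ∷ ys) E d dx≡0 =
      trans (∑-degrees-unused x (x , y) (map (x ,_) ys ++ E) d dx≡0 (inj₁ refl))
        (∑-degrees-star x ys E d dx≡0)

    ∑-degrees-avoid : ∀ v {E} d → All (λ e → ¬ Incident v e) E → d v ≢ 0 → ∑-degrees E d ≈ 0#
    ∑-degrees-avoid v {E} d avoid dv≢0 = reflexive (cong (λ Ms → ∑ Ms weight)
      (filter-none (hasDegrees? d)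
        (All.map (λ M-avoids h → dv≢0 (≡.trans (≡.sym (h v)) (deg-avoid M-avoids)))
          (All-sublists avoid))))

    -- D₁ holds the vertices to be matched other than x whose edge to x has
    -- already been decided against; D₂ those whose edge to x is still available.
    ∑-degrees-first : ∀ {x xs} → All (x ≢_) xs →
      (∀ D → D ⊆ xs → ∑-degrees (pairs xs) (count D) ≈ hafList C D) →
      ∀ ys D₁ D₂ → All (x ≢_) ys → Unique ys → All (λ y → All (y ≢_) D₁) ys →
      D₂ ⊆ ys → D₁ ++ D₂ ⊆ xs →
      ∑-degrees (map (x ,_) ys ++ pairs xs) (count (x ∷ D₁ ++ D₂)) ≈
      ∑ (picks D₂) λ (y , zs) → C x y * hafList C (D₁ ++ zs)
    -- Every edge at x has been rejected although x must be covered, so both sides are 0.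
    ∑-degrees-first {x} x∉xs rec [] D₁ [] _ _ _ [] D⊆xs =
      ∑-degrees-avoid x (count (x ∷ D₁ ++ [])) (pairs-avoid x∉xs)
        (λ eq → ℕₚ.1+n≢0 (≡.trans (≡.sym (count-self x (D₁ ++ []))) eq))
    -- Here y is not to be covered, which rules out its edge to x.
    ∑-degrees-first {x} {xs} x∉xs rec (y ∷ ys) D₁ D₂ (x≢y ∷ x∉ys) (y∉ys ∷ uniq) (y∉D₁ ∷ ys∉D₁) (.y ∷ʳ D₂⊆ys) D⊆xs =
      trans (∑-degrees-unused y (x , y) (map (x ,_) ys ++ pairs xs) (count (x ∷ D₁ ++ D₂))
          (count-avoid ((x≢y ∘ ≡.sym) ∷ ++⁺ y∉D₁ (All-resp-⊆ D₂⊆ys y∉ys))) (inj₂ refl))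
        (∑-degrees-first x∉xs rec ys D₁ D₂ x∉ys uniq ys∉D₁ D₂⊆ys D⊆xs)
    ∑-degrees-first {x} {xs} x∉xs rec (y ∷ ys) D₁ (.y ∷ D₂) (x≢y ∷ x∉ys) (y∉ys ∷ uniq) (y∉D₁ ∷ ys∉D₁) (refl ∷ D₂⊆ys) D⊆xs = begin
      ∑-degrees ((x , y) ∷ E) (count (x ∷ D₁ ++ y ∷ D₂))
        -- If the edge is used, x is saturated, its later edges drop out and `rec` applies to
        -- `D₁ ++ D₂`. If it is rejected, y moves to the end of `D₁`, which preserves the order of
        -- the list.
        ≈⟨ ∑-degrees-used E _ (count (D₁ ++ D₂)) (count-edge x≢y D₁ D₂) ⟩
      C x y * ∑-degrees E (count (D₁ ++ D₂)) + ∑-degrees E (count (x ∷ D₁ ++ y ∷ D₂))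
        ≈⟨ +-cong
          (*-congˡ (trans (∑-degrees-star x ys (pairs xs) _ (count-avoid (All-resp-⊆ D₁D₂⊆xs x∉xs)))
            (rec (D₁ ++ D₂) D₁D₂⊆xs)))
          (reflexive (cong (λ D → ∑-degrees E (count (x ∷ D))) (≡.sym (++-assoc D₁ (y ∷ []) D₂)))) ⟩
      C x y * hafList C (D₁ ++ D₂) + ∑-degrees E (count (x ∷ (D₁ ++ y ∷ []) ++ D₂))
        ≈⟨ +-congˡ (∑-degrees-first x∉xs rec ys (D₁ ++ y ∷ []) D₂ x∉ys uniq
          (All.zipWith (λ (y′∉D₁ , y≢y′) → ∷ʳ⁺ y′∉D₁ (y≢y′ ∘ ≡.sym)) (ys∉D₁ , y∉ys)) D₂⊆ys
          (subst (_⊆ xs) (≡.sym (++-assoc D₁ (y ∷ []) D₂)) D⊆xs)) ⟩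
      C x y * hafList C (D₁ ++ D₂) + ∑ (picks D₂) (λ (z , zs) → C x z * hafList C ((D₁ ++ y ∷ []) ++ zs))
        ≈⟨ +-congˡ (∑-cong (picks D₂) (λ (z , zs) →
          *-congˡ (reflexive (cong (hafList C) (++-assoc D₁ (y ∷ []) zs))))) ⟩
      C x y * hafList C (D₁ ++ D₂) + ∑ (picks D₂) (λ (z , zs) → C x z * hafList C (D₁ ++ y ∷ zs))
        ≡⟨ cong (C x y * hafList C (D₁ ++ D₂) +_) (≡.sym (∑-map _ (map₂ (y ∷_)) (picks D₂))) ⟩
      ∑ (picks (y ∷ D₂)) (λ (z , zs) → C x z * hafList C (D₁ ++ zs)) ∎
      where
      E = map (x ,_) ys ++ pairs xs
      D₁D₂⊆xs : D₁ ++ D₂ ⊆ xs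
      D₁D₂⊆xs = ⊆-trans (⊆-++⁺ (⊆-refl {x = D₁}) (y ∷ʳ ⊆-refl)) D⊆xs

    -- The edge set stays that of `xs` while D shrinks, because the edges at a matched partner
    -- remain in the list. The first vertex of `xs` either lies outside D, so that its star drops
    -- out, or is the head of D, where `∑-degrees-first` yields the expansion.
    ∑-degrees-pairs : ∀ {xs} → Unique xs → ∀ D → D ⊆ xs →
      ∑-degrees (pairs xs) (count D) ≈ hafList C D
    ∑-degrees-pairs [] [] [] = trans
      (reflexive (cong (λ Ms → ∑ Ms weight) (filter-all (hasDegrees? (count [])) ((λ _ → refl) ∷ []))))
      (+-identityʳ 1#)
    ∑-degrees-pairs {x ∷ xs} (x∉xs ∷ uniq) D (.x ∷ʳ D⊆xs) =
      trans (∑-degrees-star x xs (pairs xs) (count D) (count-avoid (All-resp-⊆ D⊆xs x∉xs)))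
        (∑-degrees-pairs uniq D D⊆xs)
    ∑-degrees-pairs {x ∷ xs} (x∉xs ∷ uniq) (.x ∷ D) (refl ∷ D⊆xs) =
      trans (∑-degrees-first x∉xs (∑-degrees-pairs uniq) xs [] D x∉xs uniq
          (All.universal (λ _ → []) xs) D⊆xs D⊆xs)
        (sym (hafList-∷ C x D))

    haf≈hafList : haf C ≈ hafList C (allFin N)
    haf≈hafList = begin
      -- By definition a perfect matching is an edge set of constant degree 1.
      ∑-degrees (edges N) (λ _ → 1)
        ≡⟨ cong (λ E → ∑-degrees E (λ _ → 1)) (edges≡pairs N) ⟩
      ∑-degrees (pairs (allFin N)) (λ _ → 1)
        ≡⟨ ∑-degrees-cong (pairs (allFin N)) (λ v → ≡.sym (count-allFin N v)) ⟩
      ∑-degrees (pairs (allFin N)) (count (allFin N))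
        ≈⟨ ∑-degrees-pairs (allFin⁺ N) (allFin N) ⊆-refl ⟩
      hafList C (allFin N) ∎

  -- Hafnians of principal submatrices and of the bordered matrix.

  -- Expanding the submatrix over its positions is expanding A over the vertices at these positions,
  -- and looking up all positions of α returns α.
  haf-[] : ∀ {m} (A : Matrix Carrier m m) α → haf (A [ α ]) ≈ hafList A α
  haf-[] A α = begin
    haf (A [ α ])                                ≈⟨ haf≈hafList (A [ α ]) ⟩
    hafList (A [ α ]) (allFin (length α))        ≈⟨ hafList-map A (lookup α) (allFin (length α)) ⟨
    hafList A (map (lookup α) (allFin (length α))) ≡⟨ cong (hafList A)
      (≡.trans (map-tabulate id (lookup α)) (tabulate-lookup α)) ⟩
    hafList A α                                  ∎

  module _ {m} (A : Matrix Carrier m m) (k : ℕ) where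

    private
      r = m ∸ 2 *ᴺ k

    bordered≡adjoin : ∀ i j → bordered A k i j ≡ adjoin A (splitAt m i) (splitAt m j)
    bordered≡adjoin i j with splitAt m i
    ... | inj₁ _ with splitAt m j
    ...   | inj₁ _ = refl
    ...   | inj₂ _ = refl
    bordered≡adjoin i j | inj₂ _ with splitAt m j
    ...   | inj₁ _ = refl
    ...   | inj₂ _ = refl

    splitAt-allFin : map (splitAt m) (allFin (m +ᴺ r)) ≡ map inj₁ (allFin m) ++ map inj₂ (allFin r)
    splitAt-allFin = ≡.trans (cong (map (splitAt m)) (allFin-+ m r))
      (≡.trans (map-++ (splitAt m) (map (_↑ˡ r) (allFin m)) _)
        (cong₂ _++_
          (≡.trans (≡.sym (map-∘ (allFin m))) (map-cong (λ i → splitAt-↑ˡ m i r) (allFin m)))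
          (≡.trans (≡.sym (map-∘ (allFin r))) (map-cong (λ i → splitAt-↑ʳ m r i) (allFin r)))))

    -- Stated with a multiple, since the ring is arbitrary and has no division. The bound gives 2k +
    -- r = m, so the α of size 2k are those that omit r vertices.
    haf-bordered : 2 *ᴺ k ≤ m → haf (bordered A k) ≈ (r !) ⋆ hafₖ k A
    haf-bordered 2k≤m = begin
      haf (bordered A k)
        ≈⟨ haf≈hafList (bordered A k) ⟩
      hafList (bordered A k) (allFin (m +ᴺ r))
        ≈⟨ hafFuel-cong _ bordered≡adjoin (allFin (m +ᴺ r)) ⟩
      hafList (λ i j → adjoin A (splitAt m i) (splitAt m j)) (allFin (m +ᴺ r))
        ≈⟨ hafList-map (adjoin A) (splitAt m) (allFin (m +ᴺ r)) ⟨
      hafList (adjoin A) (map (splitAt m) (allFin (m +ᴺ r)))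
        ≡⟨ cong (hafList (adjoin A)) splitAt-allFin ⟩
      hafList (adjoin A) (map inj₁ (allFin m) ++ map inj₂ (allFin r))
        ≈⟨ hafList-adjoin A m r (allFin m) (allFin r)
          (ℕₚ.≤-reflexive (length-tabulate id)) (length-tabulate id) ⟩
      (r !) ⋆ ∑ (omit r (allFin m)) (hafList A)
        ≡⟨ cong (λ αs → (r !) ⋆ ∑ αs (hafList A)) (filter-length-sublists (2 *ᴺ k) r (allFin m)
          (≡.trans (ℕₚ.m+[n∸m]≡n 2k≤m) (≡.sym (length-tabulate id)))) ⟨
      (r !) ⋆ ∑ (Q (2 *ᴺ k) m) (hafList A)
        ≈⟨ ×-congʳ (r !) (∑-cong (Q (2 *ᴺ k) m) (haf-[] A)) ⟨
      (r !) ⋆ hafₖ k A ∎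

-- Integer multiples and division in the reals.

module ℝMultiples where

  open Real using (fromℕ; ≡⇒≈; ÷-cancel; commutativeRing; seq)
  open CommutativeRing commutativeRing
  open import Algebra.Properties.Semiring.Mult semiring using (×-assoc-*) renaming (_×_ to _⋆_)
  open import Relation.Binary.Reasoning.Setoid setoid

  -- Rationals are kept in lowest terms and do not reduce for a variable n, hence the passage
  -- through unnormalised fractions.
  suc/1 : ∀ n → ℤ.+ suc n ℚ./ 1 ≡ ℚ.1ℚ ℚ.+ ℤ.+ n ℚ./ 1
  suc/1 n = ℚₚ.toℚᵘ-injective
    (ℚᵘₚ.≃-trans (ℚₚ.toℚᵘ-fromℚᵘ (ℚᵘ.mkℚᵘ (ℤ.+ suc n) 0))
    (ℚᵘₚ.≃-trans (ℚᵘ.*≡* (cong (λ i → (ℤ.1ℤ ℤ.+ i) ℤ.* ℤ.1ℤ) (≡.sym (ℤₚ.*-identityʳ (ℤ.+ n)))))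
    (ℚᵘₚ.≃-trans (ℚᵘₚ.+-congʳ ℚᵘ.1ℚᵘ (ℚᵘₚ.≃-sym (ℚₚ.toℚᵘ-fromℚᵘ (ℚᵘ.mkℚᵘ (ℤ.+ n) 0))))
      (ℚᵘₚ.≃-sym (ℚₚ.toℚᵘ-homo-+ ℚ.1ℚ (ℤ.+ n ℚ./ 1))))))

  ⋆≈*-fromℕ : ∀ n x → n ⋆ x ≈ x * fromℕ n
  ⋆≈*-fromℕ n x = ≡⇒≈ {n ⋆ x} {x * fromℕ n} (seq-⋆ n)
    where
    seq-⋆ : ∀ n i → seq (n ⋆ x) i ≡ seq x i ℚ.* (ℤ.+ n ℚ./ 1)
    seq-⋆ zero    i = ≡.sym (ℚₚ.*-zeroʳ (seq x i))
    seq-⋆ (suc n) i = ≡.trans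
      (cong₂ ℚ._+_ (≡.sym (ℚₚ.*-identityʳ (seq x i))) (seq-⋆ n i))
      (≡.trans (≡.sym (ℚₚ.*-distribˡ-+ (seq x i) ℚ.1ℚ (ℤ.+ n ℚ./ 1)))
        (cong (seq x i ℚ.*_) (≡.sym (suc/1 n))))

  -- Dividing x by n and multiplying back gives x; the multiplication is an n-fold sum, from which
  -- the factor 1/n is pulled out.
  ≈⋆⇒÷≈ : ∀ n .{{_ : NonZero n}} x y → y ≈ n ⋆ x → x ≈ (y Real.÷ n)
  ≈⋆⇒÷≈ n x y y≈nx = begin
    x                      ≈⟨ ÷-cancel x n ⟨
    (x * 1/n) * fromℕ n    ≈⟨ ⋆≈*-fromℕ n (x * 1/n) ⟨
    n ⋆ (x * 1/n)          ≈⟨ ×-assoc-* n x 1/n ⟨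
    (n ⋆ x) * 1/n          ≈⟨ *-cong {n ⋆ x} {y} {1/n} {1/n} (sym {y} {n ⋆ x} y≈nx) (≈-refl {1/n}) ⟩
    y * 1/n                ∎
    where
    open CommutativeRing commutativeRing using () renaming (refl to ≈-refl)
    1/n = Real.fromℚ (ℤ.+ 1 ℚ./ n)

open import Defs
open import Data.Nat using (_*_; _/_)

theorem3p1 : (m : ℕ) → 2 ≤ m →
    (A : Matrix ℝ m m) →
    (∀ i j → A i j ≈ℝ A j i) →
    (∀ i → A i i ≈ℝ 0ℝ) →
    (∀ i j → 0ℝ ≤ℝ A i j) →
    (k : ℕ) → 1 ≤ k → k ≤ m / 2 →
    hafₖ k A ≈ℝ (haf (bordered A k) ÷ℝ (m ∸ 2 * k) !) {{(m ∸ 2 * k) !≢0}}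
theorem3p1 m _ A _ _ _ k _ k≤m/2 =
  ℝMultiples.≈⋆⇒÷≈ ((m ∸ 2 * k) !) {{(m ∸ 2 * k) !≢0}} (hafₖ k A) (haf (bordered A k))
    (Expansion.haf-bordered Real.commutativeRing A k 2k≤m)
  where
  2k≤m : 2 * k ≤ m
  2k≤m = ℕₚ.≤-trans (ℕₚ.*-monoʳ-≤ 2 k≤m/2)
    (ℕₚ.≤-trans (ℕₚ.≤-reflexive (ℕₚ.*-comm 2 (m / 2))) (m/n*n≤m m 2))
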